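{- A structural abstract logic $\mathcal{S}$ in a propositional language $\mathcal{L}$ is uniform if, and only if, it is determined by a uniform bundle (equivalently, a uniform atlas) of $\mathcal{L}$-matrices, i.e. there is a uniform bundle $\mathcal{B}$ of $\mathcal{L}$-matrices with $\vdash_{\mathcal{S}}\,=\,\vdash_{\mathcal{B}}$.
   Context: $\mathcal{L}$ is an abstract propositional language, given by a set $\mathcal{V}_{\mathcal{L}}$ of variables, a set of constants and a set of finitary connectives. $\mathbf{Fm}_{\mathcal{L}}$ is the set of all $\mathcal{L}$-formulae; $\mathcal{V}(\alpha)$ is the set of variables occurring in $\alpha$, and $\mathcal{V}(X)=\bigcup_{\alpha\in X}\mathcal{V}(\alpha)$ for $X\subseteq\mathbf{Fm}_{\mathcal{L}}$. For $\mathcal{V}\subseteq\mathcal{V}_{\mathcal{L}}$, $\mathbf{Fm}_{\mathcal{L}}[\mathcal{V}]=\{\alpha\in\mathbf{Fm}_{\mathcal{L}} : \mathcal{V}(\alpha)\subseteq\mathcal{V}\}$. A structural abstract logic $\mathcal{S}$ is given by a (not necessarily finitary) consequence relation $\vdash_{\mathcal{S}}$ on $\mathbf{Fm}_{\mathcal{L}}$ (reflexive, monotone, transitive/closed under cut) closed under substitutions, equivalently by its consequence operator $\mathbf{Cn}_{\mathcal{S}}(X)=\{\alpha : X\vdash_{\mathcal{S}}\alpha\}$. $\mathcal{S}$ is uniform if for all $X,Y\subseteq\mathbf{Fm}_{\mathcal{L}}$ and $\alpha\in\mathbf{Fm}_{\mathcal{L}}$ such that $\mathcal{V}(X\cup\{\alpha\})\cap\mathcal{V}(Y)=\varnothing$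 and $Y$ is consistent (i.e. $\mathbf{Cn}_{\mathcal{S}}(Y)\neq\mathbf{Fm}_{\mathcal{L}}$): $X\cup Y\vdash_{\mathcal{S}}\alpha$ implies $X\vdash_{\mathcal{S}}\alpha$. An $\mathcal{L}$-matrix is a pair $\mathbf{M}=\langle\mathbf{A},D\rangle$ with $\mathbf{A}$ an algebra of the signature of $\mathcal{L}$ and $D\subseteq|\mathbf{A}|$ (its logical filter). $X\models_{\mathbf{M}}\alpha$ means: for every valuation $v$ in $\mathbf{A}$ (homomorphism from the formula algebra to $\mathbf{A}$), if $v[X]\subseteq D$ then $v[\alpha]\in D$. For a nonempty family $\mathcal{M}=\{\mathbf{M}_i\}_{i\in I}$, $X\vdash_{\mathcal{M}}\alpha$ iff $X\models_{\mathbf{M}_i}\alpha$ for each $i\in I$. A nonempty family of $\mathcal{L}$-matrices is a bundle if its algebras are pairwise isomorphic. An atlas is a pair $\langle\mathbf{A},\{D_i\}_{i\in I}\rangle$ with each $D_i\subseteq|\mathbf{A}|$; its corresponding bundle is $\{\langle\mathbf{A},D_i\rangle\}_{i\in I}$, and its consequence is that of the corresponding bundle. For an $\mathcal{L}$-matrix $\mathbf{M}=\langle\mathbf{A},D\rangle$, $\mathfrak{S}(\mathbf{M})$ is the set of all $X\subseteq\mathbf{Fm}_{\mathcal{L}}$ such that $X=\{\alpha\in\mathbf{Fm}_{\mathcal{L}} : v[\alpha]\in D\}$ for some valuation $v$ in $\mathbf{A}$. A bundle $\{\mathbf{M}_i\}_{i\in I}$ is uniform if for all $X,Y\subseteq\mathbf{Fm}_{\mathcal{L}}$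 with $X\subseteq\mathbf{Fm}_{\mathcal{L}}[\mathcal{V}_{\mathcal{L}}\setminus\mathcal{V}(Y)]$, all $i,j\in I$, all $Z_i\in\mathfrak{S}(\mathbf{M}_i)$ and $Z_j\in\mathfrak{S}(\mathbf{M}_j)$, there are $k\in I$ and $Z_k\in\mathfrak{S}(\mathbf{M}_k)$ such that: if $X\subseteq Z_i$ and $Y\subseteq Z_j\subsetneq\mathbf{Fm}_{\mathcal{L}}$, then $Z_i\cap\mathbf{Fm}_{\mathcal{L}}[\mathcal{V}_{\mathcal{L}}\setminus\mathcal{V}(Y)]=Z_k\cap\mathbf{Fm}_{\mathcal{L}}[\mathcal{V}_{\mathcal{L}}\setminus\mathcal{V}(Y)]$ and $Z_j\cap\mathbf{Fm}_{\mathcal{L}}[\mathcal{V}(Y)]\subseteq Z_k$. An atlas is uniform if its corresponding bundle is uniform. -}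

module Defs where

open import Level using (Level; _⊔_) renaming (suc to lsuc)
open import Data.Nat.Base using (ℕ)
open import Data.Product using (Σ-syntax; ∃-syntax; _×_; _,_)
open import Data.Vec.Base using (Vec; map)
open import Data.Vec.Properties using (map-id)
open import Data.Vec.Relation.Unary.Any using (Any)
open import Function.Base using (id)
open import Function.Bundles using (_⇔_)
open import Function.Definitions using (Bijective)
open import Function.Construct.Identity using (bijective)
open import Relation.Binary.PropositionalEquality
  using (_≡_; refl; sym; cong)
open import Relation.Nullary.Negation.Core using (¬_)
open import Relation.Unary
  using (Pred; _∈_; _⊆_; _⊂_; _≐_; _∪_; _∩_; ∁; U; ｛_｝; Empty)

private
  variable
    ℓ a b ι : Level

record Language (ℓ : Level) : Set (lsuc ℓ) where
  field
    Var        : Set ℓ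
    Constant   : Set ℓ
    Connective : Set ℓ
    arity      : Connective → ℕ

open Language

data Formula (L : Language ℓ) : Set ℓ where
  var   : Var L → Formula L
  const : Constant L → Formula L
  app   : (c : Connective L) → Vec (Formula L) (arity L c) → Formula L

data OccursIn {L : Language ℓ} (x : Var L) : Formula L → Set ℓ where
  here  : OccursIn x (var x)
  there : ∀ {c ts} → Any (OccursIn x) ts → OccursIn x (app c ts)

-- Equality of sets of formulae is always mutual inclusion _≐_, never _≡_.

FormulaSet : Language ℓ → Set (lsuc ℓ)
FormulaSet {ℓ} L = Pred (Formula L) ℓ

𝒱 : {L : Language ℓ} → FormulaSet L → Pred (Var L) ℓ
𝒱 X x = ∃[ α ] (α ∈ X × OccursIn x α)

Fm[_] : {L : Language ℓ} → Pred (Var L) ℓ → FormulaSet L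
Fm[ V ] α = ∀ x → OccursIn x α → x ∈ V

record Algebra (L : Language ℓ) (a : Level) : Set (ℓ ⊔ lsuc a) where
  field
    Carrier : Set a
    ⟦_⟧₀    : Constant L → Carrier
    ⟦_⟧     : (c : Connective L) → Vec Carrier (arity L c) → Carrier

open Algebra

formulaAlgebra : (L : Language ℓ) → Algebra L ℓ
formulaAlgebra L = record { Carrier = Formula L ; ⟦_⟧₀ = const ; ⟦_⟧ = app }

record Homomorphism {L : Language ℓ} (A : Algebra L a) (B : Algebra L b)
       : Set (ℓ ⊔ a ⊔ b) where
  field
    apply     : Carrier A → Carrier B
    map-const : ∀ k → apply (⟦ A ⟧₀ k) ≡ ⟦ B ⟧₀ k
    map-op    : ∀ c xs → apply (⟦ A ⟧ c xs) ≡ ⟦ B ⟧ c (map apply xs)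

open Homomorphism

record Isomorphism {L : Language ℓ} (A : Algebra L a) (B : Algebra L b)
       : Set (ℓ ⊔ a ⊔ b) where
  field
    hom         : Homomorphism A B
    isBijective : Bijective _≡_ _≡_ (apply hom)

isomorphism-refl : {L : Language ℓ} (A : Algebra L a) → Isomorphism A A
isomorphism-refl A = record
  { hom = record
    { apply     = id
    ; map-const = λ _ → refl
    ; map-op    = λ c xs → cong (⟦ A ⟧ c) (sym (map-id xs))
    }
  ; isBijective = bijective _≡_
  }

Valuation : {L : Language ℓ} → Algebra L a → Set (ℓ ⊔ a)
Valuation {L = L} A = Homomorphism (formulaAlgebra L) A

Substitution : Language ℓ → Set ℓ
Substitution L = Valuation (formulaAlgebra L)

_[_]ₛ : {L : Language ℓ} → Substitution L → FormulaSet L → FormulaSet L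
(σ [ X ]ₛ) β = ∃[ α ] (α ∈ X × apply σ α ≡ β)

record Logic (L : Language ℓ) : Set (lsuc ℓ) where
  infix 4 _⊢_
  field
    _⊢_        : FormulaSet L → Formula L → Set ℓ
    reflexive  : ∀ {X α} → α ∈ X → X ⊢ α
    monotone   : ∀ {X Y α} → X ⊆ Y → X ⊢ α → Y ⊢ α
    cut        : ∀ {X Y : FormulaSet L} {α} →
                 (∀ {β} → β ∈ Y → X ⊢ β) → X ∪ Y ⊢ α → X ⊢ α
    structural : ∀ {X α} (σ : Substitution L) → X ⊢ α → σ [ X ]ₛ ⊢ apply σ α

  Cn : FormulaSet L → FormulaSet L
  Cn X α = X ⊢ α

  Consistent : FormulaSet L → Set ℓ
  Consistent Y = ¬ (Cn Y ≐ U)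

  Uniform : Set (lsuc ℓ)
  Uniform = ∀ (X Y : FormulaSet L) α →
    Empty (𝒱 (X ∪ ｛ α ｝) ∩ 𝒱 Y) →
    Consistent Y →
    X ∪ Y ⊢ α → X ⊢ α

record Matrix (L : Language ℓ) (a : Level) : Set (lsuc (ℓ ⊔ a)) where
  field
    algebra : Algebra L a
    filter  : Pred (Carrier algebra) ℓ

  -- v ⁻¹ is the set of formulae that v sends into the filter.
  _⁻¹ : Valuation algebra → FormulaSet L
  (v ⁻¹) α = apply v α ∈ filter

  infix 4 _⊨_
  _⊨_ : FormulaSet L → Formula L → Set (ℓ ⊔ a)
  X ⊨ α = (v : Valuation algebra) → (∀ {β} → β ∈ X → apply v β ∈ filter) →
          apply v α ∈ filter

  𝔖 : Pred (FormulaSet L) (ℓ ⊔ a)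
  𝔖 X = Σ[ v ∈ Valuation algebra ] X ≐ v ⁻¹

record Bundle (L : Language ℓ) (a ι : Level) : Set (lsuc (ℓ ⊔ a ⊔ ι)) where
  field
    Index      : Set ι
    nonempty   : Index
    matrix     : Index → Matrix L a
    isomorphic : ∀ i j → Isomorphism (Matrix.algebra (matrix i))
                                     (Matrix.algebra (matrix j))

  infix 4 _⊢_
  _⊢_ : FormulaSet L → Formula L → Set (ℓ ⊔ a ⊔ ι)
  X ⊢ α = ∀ i → let open Matrix (matrix i) in X ⊨ α

  𝔖 : Index → Pred (FormulaSet L) (ℓ ⊔ a)
  𝔖 i = Matrix.𝔖 (matrix i)

  Uniform : Set (lsuc ℓ ⊔ a ⊔ ι)
  Uniform = ∀ (X Y : FormulaSet L) → X ⊆ Fm[ ∁ (𝒱 Y) ] →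
    ∀ i j (Zᵢ Zⱼ : FormulaSet L) → Zᵢ ∈ 𝔖 i → Zⱼ ∈ 𝔖 j →
    Σ[ k ∈ Index ] Σ[ Zₖ ∈ FormulaSet L ] (Zₖ ∈ 𝔖 k ×
      (X ⊆ Zᵢ × Y ⊆ Zⱼ × Zⱼ ⊂ U →
       (Zᵢ ∩ Fm[ ∁ (𝒱 Y) ] ≐ Zₖ ∩ Fm[ ∁ (𝒱 Y) ]) ×
       (Zⱼ ∩ Fm[ 𝒱 Y ] ⊆ Zₖ)))

record Atlas (L : Language ℓ) (a ι : Level) : Set (lsuc (ℓ ⊔ a ⊔ ι)) where
  field
    algebra  : Algebra L a
    Index    : Set ι
    nonempty : Index
    filter   : Index → Pred (Carrier algebra) ℓ

  bundle : Bundle L a ι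
  bundle = record
    { Index      = Index
    ; nonempty   = nonempty
    ; matrix     = λ i → record { algebra = algebra ; filter = filter i }
    ; isomorphic = λ _ _ → isomorphism-refl algebra
    }

  Uniform : Set (lsuc ℓ ⊔ a ⊔ ι)
  Uniform = Bundle.Uniform bundle

_DeterminedByBundle_ : {L : Language ℓ} → Logic L → Bundle L a ι →
                       Set (lsuc ℓ ⊔ a ⊔ ι)
S DeterminedByBundle B = ∀ X α → (X ⊢S α) ⇔ (X ⊢B α)
  where
  open Logic S using () renaming (_⊢_ to _⊢S_)
  open Bundle B using () renaming (_⊢_ to _⊢B_)

_DeterminedByAtlas_ : {L : Language ℓ} → Logic L → Atlas L a ι →
                      Set (lsuc ℓ ⊔ a ⊔ ι)
S DeterminedByAtlas 𝒜 = S DeterminedByBundle (Atlas.bundle 𝒜)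

{-# OPTIONS --safe #-}
module Submission where

-- Every member of 𝔖 of a determining matrix is a theory of the logic.  The
-- Lindenbaum atlas has the formula algebra as its algebra and the sets Cn T as
-- its filters, so the members of its 𝔖's are exactly the theories.  When the
-- logic is uniform, theories Zᵢ and Zⱼ, with Zⱼ consistent, are amalgamated by
-- Zₖ = Cn ((Zᵢ ∩ Fm[ ∁ (𝒱 Y) ]) ∪ (Zⱼ ∩ Fm[ 𝒱 Y ])).  Conversely, in a uniform
-- bundle, a countermodel Zᵢ of X ⊢ α and a Zⱼ witnessing the consistency of Y
-- are amalgamated into a countermodel Zₖ of X ∪ Y ⊢ α.

open import Level using (Level; _⊔_; Lift; lift; lower) renaming (suc to lsuc)
open import Axiom.ExcludedMiddle using (ExcludedMiddle)
open import Data.Product using (Σ-syntax; _×_; _,_; proj₁; proj₂)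
open import Data.Sum.Base using (inj₁; inj₂; [_,_]′)
open import Data.Unit.Base using (tt)
open import Data.Vec.Base using (map)
open import Data.Vec.Properties using (map-id; map-∘)
open import Function.Base using (_∘_)
open import Function.Bundles using (_⇔_; mk⇔; Equivalence)
open import Relation.Binary.PropositionalEquality
  using (refl; sym; trans; cong)
open import Relation.Nullary.Decidable.Core using (decidable-stable)
open import Relation.Unary using (_∈_; _⊆_; _∪_; _∩_; ∁; ｛_｝; Empty)
open import Relation.Unary.Polymorphic using (∅)
open import Defs

private
  variable
    ℓ b κ : Level
    L : Language ℓ

⊆-Fm[𝒱] : (X : FormulaSet L) → X ⊆ Fm[ 𝒱 X ]
⊆-Fm[𝒱] X {β} β∈X _ x∈β = β , β∈X , x∈β

disjoint⇒⊆-Fm[∁𝒱] : {X Y : FormulaSet L} → Empty (𝒱 X ∩ 𝒱 Y) → X ⊆ Fm[ ∁ (𝒱 Y) ]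
disjoint⇒⊆-Fm[∁𝒱] disjoint {β} β∈X x x∈β x∈Y = disjoint x ((β , β∈X , x∈β) , x∈Y)

-- If `v` satisfied `X` but not `α`, then no `w` could satisfy `Y` and refute some `β`, since
-- `amalgamate` would force `v` to satisfy `α`. So `Y` would derive every `β`, against its
-- consistency.
uniform-bundle⇒uniform : ExcludedMiddle ℓ → {L : Language ℓ} (S : Logic L)
  (B : Bundle L b κ) → Bundle.Uniform B → S DeterminedByBundle B → Logic.Uniform S
uniform-bundle⇒uniform em S B uniform determined X Y α disjoint Y-consistent X∪Y⊢α =
  from (determined X α) λ i v v[X] →
    decidable-stable em λ vα∉D →
      Y-consistent
        ( (λ _ → tt)
        , λ {β} _ → from (determined Y β) λ j w w[Y] →
            decidable-stable em λ wβ∉D →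
              vα∉D (amalgamate i v v[X] j w w[Y] β wβ∉D)
        )
  where
  open Equivalence
  open Bundle B using (matrix)
  open Matrix using (algebra; _⁻¹)

  X∪α⊆ : X ∪ ｛ α ｝ ⊆ Fm[ ∁ (𝒱 Y) ]
  X∪α⊆ = disjoint⇒⊆-Fm[∁𝒱] disjoint

  amalgamate : ∀ i (v : Valuation (algebra (matrix i))) → X ⊆ _⁻¹ (matrix i) v →
               ∀ j (w : Valuation (algebra (matrix j))) → Y ⊆ _⁻¹ (matrix j) w →
               ∀ β → β ∈ ∁ (_⁻¹ (matrix j) w) → α ∈ _⁻¹ (matrix i) v
  amalgamate i v v[X] j w w[Y] β wβ∉D
    with k , Zₖ , (u , Zₖ⊆ , ⊆Zₖ) , amalgam ←
           -- The two theories are the preimages of the filters under `v` and `w`; `wβ∉D` below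
           -- shows that the second is proper.
           uniform X Y (X∪α⊆ ∘ inj₁) i j _ _
             (v , (λ p → p) , λ p → p) (w , (λ p → p) , λ p → p)
    with (Zᵢ⊆Zₖ , Zₖ⊆Zᵢ) , Zⱼ⊆Zₖ ←
           amalgam (v[X] , w[Y] , (λ _ → tt) , λ U⊆Zⱼ → wβ∉D (U⊆Zⱼ tt))
    -- `α` shares no variable with `Y`, and on such formulae `Zₖ` agrees with the preimage under
    -- `v`.
    = proj₁ (Zₖ⊆Zᵢ (⊆Zₖ uα∈D , X∪α⊆ (inj₂ refl)))
    where
    X⊆Zₖ : X ⊆ Zₖ
    X⊆Zₖ γ∈X = proj₁ (Zᵢ⊆Zₖ (v[X] γ∈X , X∪α⊆ (inj₁ γ∈X)))

    Y⊆Zₖ : Y ⊆ Zₖ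
    Y⊆Zₖ γ∈Y = Zⱼ⊆Zₖ (w[Y] γ∈Y , ⊆-Fm[𝒱] Y γ∈Y)

    uα∈D : α ∈ _⁻¹ (matrix k) u
    uα∈D = to (determined (X ∪ Y) α) X∪Y⊢α k u (Zₖ⊆ ∘ [ X⊆Zₖ , Y⊆Zₖ ]′)

-- A copy of `formulaAlgebra`, with `Lift` making room for any carrier level above `ℓ`.
liftedFormulaAlgebra : (a : Level) (L : Language ℓ) → Algebra L (ℓ ⊔ a)
liftedFormulaAlgebra a L = record
  { Carrier = Lift a (Formula L)
  ; ⟦_⟧₀    = λ k → lift (const k)
  ; ⟦_⟧     = λ c xs → lift (app c (map lower xs))
  }

module _ {a : Level} {L : Language ℓ} where

  open Homomorphism

  -- This is the identity substitution in disguise; through it each `Cn T` is itself a member of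
  -- `𝔖`.
  lift-valuation : Valuation (liftedFormulaAlgebra a L)
  lift-valuation = record
    { apply     = lift
    ; map-const = λ _ → refl
    ; map-op    = λ c xs → cong (lift ∘ app c) (trans (sym (map-id xs)) (map-∘ lower lift xs))
    }

  toSubstitution : Valuation (liftedFormulaAlgebra a L) → Substitution L
  toSubstitution v = record
    { apply     = lower ∘ apply v
    ; map-const = λ k → cong lower (map-const v k)
    ; map-op    = λ c xs → trans (cong lower (map-op v c xs))
                                 (cong (app c) (sym (map-∘ lower (apply v) xs)))
    }

lindenbaumAtlas : (a ι : Level) {L : Language ℓ} → Logic L →
                  Atlas L (ℓ ⊔ a) (lsuc ℓ ⊔ ι)
lindenbaumAtlas a ι {L} S = record
  { algebra  = liftedFormulaAlgebra a L
  ; Index    = Lift ι (FormulaSet L)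
  ; nonempty = lift ∅
  ; filter   = λ T α → lower T ⊢ lower α
  }
  where open Logic S

module _ (a ι : Level) {L : Language ℓ} (S : Logic L) where

  open Logic S
  open Homomorphism using (apply)
  open Bundle (Atlas.bundle (lindenbaumAtlas a ι S)) using (𝔖) renaming (_⊢_ to _⊢ᴬ_)

  cut-⊆ : {X Y : FormulaSet L} {α : Formula L} → Y ⊆ Cn X → Y ⊢ α → X ⊢ α
  cut-⊆ {Y = Y} Y⊆CnX Y⊢α = cut {Y = Y} Y⊆CnX (monotone inj₂ Y⊢α)

  -- Structurality derives `apply σ α` from the image of `X`, and cut replaces that image by `T`.
  ⊢-preimage : ∀ {X T α} (σ : Substitution L) →
               (∀ {β} → β ∈ X → T ⊢ apply σ β) → X ⊢ α → T ⊢ apply σ α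
  ⊢-preimage σ σ[X] X⊢α =
    cut-⊆ (λ { (_ , β∈X , refl) → σ[X] β∈X }) (structural σ X⊢α)

  -- `Z` is the preimage of a theory under a substitution, hence again a theory.
  𝔖-closed : ∀ i {Z} → Z ∈ 𝔖 i → Cn Z ⊆ Z
  𝔖-closed T {Z} (v , Z⊆ , ⊆Z) Z⊢α =
    ⊆Z (⊢-preimage {Z} {lower T} (toSubstitution v) Z⊆ Z⊢α)

  lindenbaum-determines : S DeterminedByAtlas (lindenbaumAtlas a ι S)
  -- Completeness: the filter `Cn X` with the identity valuation already tests every `α`.
  lindenbaum-determines X α = mk⇔ sound λ X⊨α → X⊨α (lift X) lift-valuation reflexive
    where
    sound : X ⊢ α → X ⊢ᴬ α
    sound X⊢α T v v[X] = ⊢-preimage {X} {lower T} (toSubstitution v) v[X] X⊢α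

  lindenbaum-uniform : Uniform → Atlas.Uniform (lindenbaumAtlas a ι S)
  lindenbaum-uniform uniform X Y _ i j Zᵢ Zⱼ Zᵢ∈𝔖 Zⱼ∈𝔖 =
    lift (X′ ∪ Y′) , Cn (X′ ∪ Y′) , (lift-valuation , (λ p → p) , λ p → p) ,
    λ (_ , _ , _ , U⊈Zⱼ) →
      ( (λ (α∈Zᵢ , α∈Fm) → reflexive (inj₁ (α∈Zᵢ , α∈Fm)) , α∈Fm)
      , (λ {α} (Zₖ⊢α , α∈Fm) →
           -- Uniformity discards the premises `Y′`, leaving `X′ ⊢ α` with `X′` inside the theory
           -- `Zᵢ`.
           𝔖-closed i Zᵢ∈𝔖 (monotone proj₁
             (uniform X′ Y′ α (disjoint α∈Fm)
               -- `Y′` is consistent because its consequences stay inside the proper theory `Zⱼ`.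
               (λ (_ , U⊆CnY′) → U⊈Zⱼ (𝔖-closed j Zⱼ∈𝔖 ∘ monotone proj₁ ∘ U⊆CnY′))
               Zₖ⊢α))
         , α∈Fm)
      )
      , reflexive ∘ inj₂
    where
    X′ Y′ : FormulaSet L
    X′ = Zᵢ ∩ Fm[ ∁ (𝒱 Y) ]
    Y′ = Zⱼ ∩ Fm[ 𝒱 Y ]

    disjoint : ∀ {α} → α ∈ Fm[ ∁ (𝒱 Y) ] → Empty (𝒱 (X′ ∪ ｛ α ｝) ∩ 𝒱 Y′)
    disjoint α∈Fm x ((_ , inj₁ (_ , β∈Fm) , x∈β) , _ , (_ , γ∈Fm) , x∈γ) =
      β∈Fm x x∈β (γ∈Fm x x∈γ)
    disjoint α∈Fm x ((_ , inj₂ refl , x∈α) , _ , (_ , γ∈Fm) , x∈γ) =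
      α∈Fm x x∈α (γ∈Fm x x∈γ)

corollary2p2p1 : ∀ {ℓ : Level} (a ι : Level) → ExcludedMiddle ℓ →
    (L : Language ℓ) (S : Logic L) →
    (Logic.Uniform S ⇔
    (Σ[ B ∈ Bundle L (ℓ ⊔ a) (lsuc ℓ ⊔ ι) ] (Bundle.Uniform B × S DeterminedByBundle B)))
    ×
    (Logic.Uniform S ⇔
    (Σ[ 𝒜 ∈ Atlas L (ℓ ⊔ a) (lsuc ℓ ⊔ ι) ] (Atlas.Uniform 𝒜 × S DeterminedByAtlas 𝒜)))
corollary2p2p1 a ι em L S =
    mk⇔ (λ uniform → Atlas.bundle 𝒜 , lindenbaum-uniform a ι S uniform , determined)
        (λ (B , uniform , det) → uniform-bundle⇒uniform em S B uniform det)
  , mk⇔ (λ uniform → 𝒜 , lindenbaum-uniform a ι S uniform , determined)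
        (λ (ℬ , uniform , det) → uniform-bundle⇒uniform em S (Atlas.bundle ℬ) uniform det)
  where
  𝒜 = lindenbaumAtlas a ι S
  determined = lindenbaum-determines a ι S
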